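{- Algorithm-B (described in the context) decides CIS with run time $O(\delta_1^n)$, where $n$ is the number of vertices of the input graph system and $\delta_1=1.6181\approx(\sqrt{5}+1)/2$. That is, on every graph system $\mathcal{G}$ it returns true if and only if $\mathcal{G}$ has a good independent set, within the stated time.
   Context: A graph system is a tuple $\mathcal{G}=(G_0,G_1,\ldots,G_m)$ with $m\ge 1$, where all $G_i$ are graphs over the same finite vertex set $V$, $G_0$ is an undirected graph without self-loops, and $G_1,\ldots,G_m$ are directed graphs that may contain self-loops. Let $E_i$ be the edge set of $G_i$. Two vertices are conflicting if they are adjacent in $G_0$. For $\Gamma\subseteq V$ and $1\le i\le m$, a vertex $u\in\Gamma$ is $G_i$-good in $\Gamma$ if there is $v\in\Gamma$ (possibly $v=u$) with $(u,v)\in E_i$; it is good in $\Gamma$ if it is $G_i$-good in $\Gamma$ for every $1\le i\le m$, and bad in $\Gamma$ otherwise. A good independent set (GIS) is a non-empty set $\Gamma\subseteq V$ that contains no two conflicting vertices and all of whose vertices are good in $\Gamma$. CIS is the problem: given $\mathcal{G}$, decide whether it has a GIS. The recursive procedure Las-Vegas$(\mathcal{G},X,Y)$, for $X\subseteq Y\subseteq V$, is: (1) if $X$ is not an independent set of $G_0$, return false; (2) remove from $Y$ all vertices that conflict with some vertex of $X$; (3) while there is a bad vertex in $Y$, remove it from $Y$; (4) if $X\not\subseteq Y$ or $Y=\emptyset$, return false; (5) if $Y$ is an independent set of $G_0$, return true; (6) otherwise pick two conflicting vertices $u,v\in Y$; if Las-Vegas$(\mathcal{G},X,Y\setminus\{u\})$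 returns true, return true; else return the result of Las-Vegas$(\mathcal{G},X\cup\{u\},Y\setminus\{v\})$. Algorithm-B, on input $\mathcal{G}$, returns Las-Vegas$(\mathcal{G},\emptyset,V)$. Running times are measured in $n=|V|$; factors polynomial in the number $m$ of directed graphs are suppressed. -}

module Defs where

open import Data.Bool using (Bool; true; false; not; _∨_; if_then_else_; T)
open import Data.Fin using (Fin)
open import Data.Fin.Subset using (Subset; _∈_; _-_; _∪_; ⁅_⁆; ⊤; ⊥; Nonempty)
open import Data.List using (List; []; _∷_; null; length; lookup; allFin; cartesianProduct)
open import Data.Nat using (ℕ; zero; suc; _≤_)
open import Data.Product using (∃; _×_; _,_)
open import Data.Vec as Vec using ()
open import Relation.Binary.PropositionalEquality using (_≡_)
open import Relation.Nullary using (¬_)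

------------------------------------------------------------------------
-- Graph systems and good independent sets

-- The vertex set is Fin n; graphs are given by adjacency matrices.
-- E i is the edge relation of the directed graph G_(i+1).

record GraphSystem (n m : ℕ) : Set where
  field
    m≥1       : 1 ≤ m
    E₀        : Fin n → Fin n → Bool
    E₀-sym    : ∀ u v → E₀ u v ≡ E₀ v u
    E₀-irrefl : ∀ u → E₀ u u ≡ false
    E         : Fin m → Fin n → Fin n → Bool

module _ {n m : ℕ} (𝒢 : GraphSystem n m) where
  open GraphSystem 𝒢

  Conflicting : Fin n → Fin n → Set
  Conflicting u v = T (E₀ u v)

  GoodFor : Fin m → Subset n → Fin n → Set
  GoodFor i Γ u = ∃ λ v → v ∈ Γ × T (E i u v)

  Good : Subset n → Fin n → Set
  Good Γ u = ∀ i → GoodFor i Γ u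

  Independent : Subset n → Set
  Independent Γ = ∀ {u v} → u ∈ Γ → v ∈ Γ → ¬ Conflicting u v

  IsGIS : Subset n → Set
  IsGIS Γ = Nonempty Γ × Independent Γ × (∀ {u} → u ∈ Γ → Good Γ u)

  HasGIS : Set
  HasGIS = ∃ IsGIS

------------------------------------------------------------------------
-- Programs

-- A program does not receive the graph system as a value: it can learn
-- about it only through queries, each of which reads one bit.

data Query (n m : ℕ) : Set where
  conflict? : Fin n → Fin n → Query n m
  edge?     : Fin m → Fin n → Fin n → Query n m
  member?   : Fin n → Subset n → Query n m

answer : {n m : ℕ} → GraphSystem n m → Query n m → Bool
answer 𝒢 (conflict? u v) = GraphSystem.E₀ 𝒢 u v
answer 𝒢 (edge? i u v)   = GraphSystem.E 𝒢 i u v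
answer 𝒢 (member? u S)   = Vec.lookup S u

-- Recursive calls are a program construct, so that programs need not
-- terminate a priori.  The while loop of step (3) is the
-- tail-recursive procedure prune.

data Call (n : ℕ) : Set where
  lasVegas : Subset n → Subset n → Call n
  prune    : Subset n → Call n

Result : {n : ℕ} → Call n → Set
Result     (lasVegas _ _) = Bool
Result {n} (prune _)      = Subset n

-- pick k is a nondeterministic choice among k + 1 ≥ 1 alternatives;
-- tick only spends time.

data Prog (n m : ℕ) (A : Set) : Set where
  return : A → Prog n m A
  tick   : Prog n m A → Prog n m A
  query  : Query n m → (Bool → Prog n m A) → Prog n m A
  pick   : (k : ℕ) → (Fin (suc k) → Prog n m A) → Prog n m A
  call   : (c : Call n) → (Result c → Prog n m A) → Prog n m A

infixl 1 _>>=_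

_>>=_ : {n m : ℕ} {A B : Set} → Prog n m A → (A → Prog n m B) → Prog n m B
return a  >>= f = f a
tick p    >>= f = tick (p >>= f)
query q k >>= f = query q (λ b → k b >>= f)
pick j k  >>= f = pick j (λ i → k i >>= f)
call c k  >>= f = call c (λ r → k r >>= f)

ask : {n m : ℕ} → Query n m → Prog n m Bool
ask q = query q return

invoke : {n m : ℕ} (c : Call n) → Prog n m (Result c)
invoke c = call c return

choose : {n m : ℕ} {A : Set} → A → List A → Prog n m A
choose x xs = pick (length xs) (λ i → return (lookup (x ∷ xs) i))

ticks : {n m : ℕ} {A : Set} → ℕ → Prog n m A → Prog n m A
ticks zero    p = p
ticks (suc t) p = tick (ticks t p)

-- The elements passing a test.  Every iteration costs one tick in
-- addition to the cost of the test itself; this also accounts for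
-- building the list that is traversed.

select : {n m : ℕ} {A : Set} → (A → Prog n m Bool) → List A → Prog n m (List A)
select test []       = return []
select test (x ∷ xs) = tick (do
  b  ← test x
  ys ← select test xs
  return (if b then x ∷ ys else ys))

-- Subsets are bit vectors of length n; creating one takes n steps.

make : {n m : ℕ} → Subset n → Prog n m (Subset n)
make {n} S = ticks n (return S)

insert remove : {n m : ℕ} → Fin n → Subset n → Prog n m (Subset n)
insert u S = make (S ∪ ⁅ u ⁆)
remove u S = make (S - u)

------------------------------------------------------------------------
-- The algorithm

module _ {n m : ℕ} where

  elements : Subset n → Prog n m (List (Fin n))
  elements S = select (λ u → ask (member? u S)) (allFin n)

  conflictsIn : Subset n → Prog n m (List (Fin n × Fin n))
  conflictsIn S = do
    us ← elements S
    select (λ (u , v) → ask (conflict? u v)) (cartesianProduct us us)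

  removeAll : List (Fin n) → Subset n → Prog n m (Subset n)
  removeAll []       Y = return Y
  removeAll (u ∷ us) Y = do
    Y′ ← remove u Y
    removeAll us Y′

  removeConflicting : Subset n → Subset n → Prog n m (Subset n)
  removeConflicting X Y = do
    xs   ← elements X
    ys   ← elements Y
    dead ← select (λ v → do
                     hits ← select (λ u → ask (conflict? u v)) xs
                     return (not (null hits)))
                  ys
    removeAll dead Y

  bad? : List (Fin n) → Fin n → Prog n m Bool
  bad? ys u = do
    failures ← select (λ i → do
                         targets ← select (λ v → ask (edge? i u v)) ys
                         return (null targets))
                      (allFin m)
    return (not (null failures))

  pruneWith : Subset n → List (Fin n) → Prog n m (Subset n)
  pruneWith Y []       = return Y
  pruneWith Y (b ∷ bs) = do
    u  ← choose b bs
    Y′ ← remove u Y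
    invoke (prune Y′)

  pruneBody : Subset n → Prog n m (Subset n)
  pruneBody Y = do
    ys   ← elements Y
    bads ← select (bad? ys) ys
    pruneWith Y bads

  -- Steps (5) and (6), given all conflicting pairs in Y.  Each such
  -- pair occurs in both orders, so any orientation may be picked.
  branch : Subset n → Subset n → List (Fin n × Fin n) → Prog n m Bool
  branch X Y []       = return true
  branch X Y (c ∷ cs) = do
    (u , v) ← choose c cs
    Y₁      ← remove u Y
    found   ← invoke (lasVegas X Y₁)
    if found then return true else do
      X₂ ← insert u X
      Y₂ ← remove v Y
      invoke (lasVegas X₂ Y₂)

  lasVegasBody : Subset n → Subset n → Prog n m Bool
  lasVegasBody X Y = do
    conflictsX ← conflictsIn X
    if not (null conflictsX) then return false else do
      Y₁      ← removeConflicting X Y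
      Y₂      ← invoke (prune Y₁)
      xs      ← elements X
      ys      ← elements Y₂
      missing ← select (λ u → do
                          b ← ask (member? u Y₂)
                          return (not b))
                       xs
      if not (null missing) ∨ null ys then return false else do
        conflictsY ← conflictsIn Y₂
        branch X Y₂ conflictsY

  body : (c : Call n) → Prog n m (Result c)
  body (lasVegas X Y) = lasVegasBody X Y
  body (prune Y)      = pruneBody Y

algorithmB : (n m : ℕ) → Prog n m Bool
algorithmB n m = do
  X ← make ⊥
  Y ← make ⊤
  invoke (lasVegas X Y)

------------------------------------------------------------------------
-- Executions and running time

-- One elementary step on the input 𝒢.  Programs of the form return a
-- are exactly those that have no successor.

data _⊢_⟶_ {n m : ℕ} (𝒢 : GraphSystem n m) {A : Set} :
           Prog n m A → Prog n m A → Set where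
  tick  : ∀ p → 𝒢 ⊢ tick p ⟶ p
  query : ∀ q k → 𝒢 ⊢ query q k ⟶ k (answer 𝒢 q)
  pick  : ∀ j k i → 𝒢 ⊢ pick j k ⟶ k i
  call  : ∀ c k → 𝒢 ⊢ call c k ⟶ (body c >>= k)

-- A (possibly unfinished) execution of exactly t elementary steps.

data _⊢_⟶[_]_ {n m : ℕ} (𝒢 : GraphSystem n m) {A : Set} :
              Prog n m A → ℕ → Prog n m A → Set where
  done : ∀ {p} → 𝒢 ⊢ p ⟶[ zero ] p
  step : ∀ {p q r t} → 𝒢 ⊢ p ⟶ q → 𝒢 ⊢ q ⟶[ t ] r → 𝒢 ⊢ p ⟶[ suc t ] r

{-# OPTIONS --safe #-}
module Submission where

-- Every good independent set Γ with X ⊆ Γ ⊆ Y avoids the neighbours of X and survives pruning,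
-- and if u and v conflict, it avoids u or else contains u and avoids v; so a call of
-- lasVegas X Y decides whether such a Γ exists, except that a positive answer may be
-- witnessed by a good independent set outside these bounds.  For the time, consider the
-- number k = ∣ Y ─ X ∣.  After step (2) no vertex of X conflicts with a vertex of Y, so
-- the picked u and v both lie in Y ─ X: the first recursive call loses u, the second loses
-- u to X and v altogether.  Hence the number of calls satisfies
-- calls (k + 2) ≤ 1 + calls (k + 1) + calls k, which gives growth by the golden ratio; as
-- 1.6181 is strictly larger, the polynomial cost of a single call is absorbed.

open import Defs
open import Data.Bool using (Bool; true; false; not; _∨_; if_then_else_; T)
open import Data.Bool.Properties using (T?)
open import Data.Empty using (⊥-elim)
open import Data.Fin using (Fin; zero)
open import Data.Fin.Properties using (any?; all?; ¬∀⟶∃¬)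
open import Data.Fin.Subset using (Subset; _∈_; _∉_; _⊆_; _-_; _─_; _∪_; ⁅_⁆; ∣_∣; ⊤; ⊥; Nonempty)
open import Data.Fin.Subset.Properties
  using (_∈?_; ∈⊤; ∉⊥; x∈⁅x⁆; x∈⁅y⁆⇒x≡y; x∈p∪q⁺; x∈p∪q⁻; p─q⊆p; x∈p∧x∉q⇒x∈p─q;
         x∈p∧x≢y⇒x∈p-y; x∈p⇒∣p-x∣<∣p∣; p⊂q⇒∣p∣<∣q∣; p⊆q⇒∣p∣≤∣q∣; ∣p∣≤n)
open import Data.List using (List; []; _∷_; null; length; lookup; map; allFin; cartesianProduct)
open import Data.List.Membership.Propositional using () renaming (_∈_ to _∈ₗ_)
open import Data.List.Membership.Propositional.Properties
  using (∈-allFin; ∈-lookup; ∈-cartesianProduct⁺; ∈-cartesianProduct⁻)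
open import Data.List.Properties using (length-++; length-map; length-tabulate)
open import Data.List.Relation.Unary.Any using (here; there)
open import Data.List.Relation.Unary.Any.Properties using (¬Any[])
open import Data.Nat using (ℕ; zero; suc; _+_; _*_; _^_; _≤_; _<_; z≤n; s≤s; NonZero; >-nonZero⁻¹)
open import Data.Nat.Induction using (<-rec)
open import Data.Nat.Properties
open import Data.Nat.Tactic.RingSolver using (solve-∀)
open import Data.Product using (∃; _×_; _,_; proj₁; proj₂)
open import Data.Sum using (_⊎_; inj₁; inj₂)
open import Data.Vec using ([]; _∷_)
open import Data.Vec.Properties using ([]=⇒lookup; lookup⇒[]=)
open import Function.Base using (_∘_; id; const; it)
open import Function.Bundles using (_⇔_; mk⇔)
open import Relation.Binary.PropositionalEquality
open import Relation.Nullary using (¬_; Dec; yes; no; Reflects; ofʸ; ofⁿ; _because_; proof; _×-dec_)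
open import Relation.Nullary.Decidable using (map′; decidable-stable)
open import Relation.Nullary.Reflects using (T-reflects; ¬-reflects)

-- Reflection and list lengths.

reflects-map : ∀ {A B : Set} {b} → (A → B) → (B → A) → Reflects A b → Reflects B b
reflects-map f g r = proof (map′ f g (_ because r))

length-allFin : ∀ k → length (allFin k) ≤ k
length-allFin k = ≤-reflexive (length-tabulate id)

length-cartesianProduct : ∀ {A B : Set} (xs : List A) (ys : List B) →
  length (cartesianProduct xs ys) ≡ length xs * length ys
length-cartesianProduct []       ys = refl
length-cartesianProduct (x ∷ xs) ys = trans (length-++ (map (x ,_) ys))
  (cong₂ _+_ (length-map _ ys) (length-cartesianProduct xs ys))

-- Finite subsets and the count of undecided vertices.

x∉p─q : ∀ {n} {x : Fin n} (p q : Subset n) → x ∈ q → x ∉ p ─ q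
x∉p─q (_ ∷ p) (_ ∷ q) (Data.Vec.there x∈q) (Data.Vec.there x∈p─q) = x∉p─q p q x∈q x∈p─q
x∉p─q (_ ∷ p) (_ ∷ q) Data.Vec.here ()

x∉p-x : ∀ {n} (p : Subset n) (x : Fin n) → x ∉ p - x
x∉p-x p x = x∉p─q p ⁅ x ⁆ (x∈⁅x⁆ x)

p-x⊆p : ∀ {n} (p : Subset n) (x : Fin n) → p - x ⊆ p
p-x⊆p p x = p─q⊆p p ⁅ x ⁆

p⊆q∧x∉p⇒p⊆q-x : ∀ {n} {p q : Subset n} {x : Fin n} → p ⊆ q → x ∉ p → p ⊆ q - x
p⊆q∧x∉p⇒p⊆q-x p⊆q x∉p y∈p = x∈p∧x≢y⇒x∈p-y (p⊆q y∈p) λ { refl → x∉p y∈p }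

∈-splits : ∀ {n} {x : Fin n} (p q : Subset n) → x ∈ p ─ q → x ∈ p × x ∉ q
∈-splits p q x∈ = p─q⊆p p q x∈ , λ x∈q → x∉p─q p q x∈q x∈

─-monoˡ-⊆ : ∀ {n} {p q : Subset n} (r : Subset n) → p ⊆ q → p ─ r ⊆ q ─ r
─-monoˡ-⊆ {p = p} r p⊆q x∈ with ∈-splits p r x∈
... | x∈p , x∉r = x∈p∧x∉q⇒x∈p─q (p⊆q x∈p) x∉r

∣Y-u─X∣<∣Y─X∣ : ∀ {n} {X Y : Subset n} {u} → u ∈ Y → u ∉ X → ∣ (Y - u) ─ X ∣ < ∣ Y ─ X ∣
∣Y-u─X∣<∣Y─X∣ {X = X} {Y} {u} u∈Y u∉X = p⊂q⇒∣p∣<∣q∣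
  ( ─-monoˡ-⊆ X (p-x⊆p Y u)
  , u , x∈p∧x∉q⇒x∈p─q u∈Y u∉X , x∉p-x Y u ∘ p─q⊆p (Y - u) X )

-- The two recursive calls are compared with each other: `u` is missing on both sides, put into `X`
-- on the left and deleted on the right, while `v` is lost only on the left. Together with the
-- previous lemma this gives a drop by two.
∣Y-v─X∪u∣<∣Y-u─X∣ : ∀ {n} {X Y : Subset n} {u v} → v ∈ Y → v ∉ X → u ≢ v →
  ∣ (Y - v) ─ (X ∪ ⁅ u ⁆) ∣ < ∣ (Y - u) ─ X ∣
∣Y-v─X∪u∣<∣Y-u─X∣ {X = X} {Y} {u} {v} v∈Y v∉X u≢v = p⊂q⇒∣p∣<∣q∣
  ( included
  , v , x∈p∧x∉q⇒x∈p─q (x∈p∧x≢y⇒x∈p-y v∈Y (u≢v ∘ sym)) v∉X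
  , x∉p-x Y v ∘ p─q⊆p (Y - v) (X ∪ ⁅ u ⁆) )
  where
  included : (Y - v) ─ (X ∪ ⁅ u ⁆) ⊆ (Y - u) ─ X
  included x∈ with ∈-splits (Y - v) (X ∪ ⁅ u ⁆) x∈
  ... | x∈Y-v , x∉X∪u = x∈p∧x∉q⇒x∈p─q
    (x∈p∧x≢y⇒x∈p-y (p-x⊆p Y v x∈Y-v) λ { refl → x∉X∪u (x∈p∪q⁺ (inj₂ (x∈⁅x⁆ u))) })
    (x∉X∪u ∘ x∈p∪q⁺ ∘ inj₁)

⊆-insert : ∀ {n} {X Γ : Subset n} {u} → X ⊆ Γ → u ∈ Γ → X ∪ ⁅ u ⁆ ⊆ Γ
⊆-insert {X = X} {Γ} {u} X⊆Γ u∈Γ x∈ with x∈p∪q⁻ X ⁅ u ⁆ x∈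
... | inj₁ x∈X = X⊆Γ x∈X
... | inj₂ x∈u = subst (_∈ Γ) (sym (x∈⁅y⁆⇒x≡y u x∈u)) u∈Γ

-- Specifications of membership tests and filtering.

member-reflects : ∀ {n} (u : Fin n) (S : Subset n) → Reflects (u ∈ S) (Data.Vec.lookup S u)
member-reflects u S = reflects-map (fromT _ refl) (toT ∘ []=⇒lookup) (T-reflects _)
  where
  fromT : ∀ b → Data.Vec.lookup S u ≡ b → T b → u ∈ S
  fromT true eq _ = lookup⇒[]= u S eq
  toT : ∀ {b} → b ≡ true → T b
  toT refl = _

-- Order and multiplicity are left open; `size` feeds the cost bounds of later loops over `ys`.
record Selected {A : Set} (P : A → Set) (xs ys : List A) : Set where
  field
    sound    : ∀ {x} → x ∈ₗ ys → x ∈ₗ xs × P x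
    complete : ∀ {x} → x ∈ₗ xs → P x → x ∈ₗ ys
    size     : length ys ≤ length xs
open Selected

selected-[] : ∀ {A : Set} {P : A → Set} → Selected P [] []
selected-[] .sound ()
selected-[] .complete ()
selected-[] .size = z≤n

selected-∷ : ∀ {A : Set} {P : A → Set} {x xs ys b} → Reflects (P x) b → Selected P xs ys →
  Selected P (x ∷ xs) (if b then x ∷ ys else ys)
selected-∷ (ofʸ px) s .sound (here refl) = here refl , px
selected-∷ (ofʸ px) s .sound (there i)   = let j , p = s .sound i in there j , p
selected-∷ (ofʸ px) s .complete (here refl) _ = here refl
selected-∷ (ofʸ px) s .complete (there i)   p = there (s .complete i p)
selected-∷ (ofʸ px) s .size = s≤s (s .size)
selected-∷ (ofⁿ ¬px) s .sound i = let j , p = s .sound i in there j , p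
selected-∷ (ofⁿ ¬px) s .complete (here refl) p = ⊥-elim (¬px p)
selected-∷ (ofⁿ ¬px) s .complete (there i)   p = s .complete i p
selected-∷ (ofⁿ ¬px) s .size = m≤n⇒m≤1+n (s .size)

selected-reflects : ∀ {A : Set} {P : A → Set} {xs ys} → Selected P xs ys →
  Reflects (∃ λ x → x ∈ₗ xs × P x) (not (null ys))
selected-reflects {ys = []} s = ofⁿ λ (x , i , p) → ¬Any[] (s .complete i p)
selected-reflects {ys = y ∷ ys} s = ofʸ (y , s .sound (here refl))

-- Step counts and number of calls.

module Cost (n m : ℕ) where

  conflictsCost removeConflictingCost badCost pruneRound branchCost lasVegasRound : ℕ
  pruneCost : ℕ → ℕ

  -- The summands follow the programs line by line. A `select` over `k` items with a test of cost
  -- `c` takes `k * suc c`, so `elements` takes `n * 2`. In `pruneRound`, `branchCost` and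
  -- `lasVegasRound`, any other `suc` or `1` pays for a pick or a call.
  conflictsCost         = n * 2 + n * n * 2
  removeConflictingCost = n * 2 + (n * 2 + (n * suc (n * 2) + n * n))
  badCost               = m * suc (n * 2)
  pruneRound            = n * 2 + (n * suc badCost + suc (n + 1))
  -- At most `k` removals, and one last round that finds no bad vertex.
  pruneCost k           = suc k * pruneRound
  branchCost            = suc (n + suc (n + (n + 1)))

  -- One call of lasVegas, without its recursive calls of lasVegas.
  lasVegasRound = conflictsCost + (removeConflictingCost + suc (pruneCost n +
    (n * 2 + (n * 2 + (n * 2 + (conflictsCost + branchCost))))))

-- The argument k bounds ∣ Y ─ X ∣, the number of vertices still undecided.
childCalls calls : ℕ → ℕ
calls k = suc (childCalls k)
childCalls zero          = 0
childCalls (suc zero)    = 0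
childCalls (suc (suc k)) = calls (suc k) + calls k

-- A program logic for results and running times.

module _ {n m : ℕ} (𝒢 : GraphSystem n m) where
  open GraphSystem 𝒢
  open Cost n m

  -- Runs p t Q: every execution of p ends within t steps, and its result satisfies Q.
  -- The rule for calls mentions only the body of the callee, not the composed program:
  -- without function extensionality, _>>=_ is not associative.
  data Runs {A : Set} : Prog n m A → ℕ → (A → Set) → Set₁ where
    return : ∀ {a t Q} → Q a → Runs (return a) t Q
    tick   : ∀ {p t Q} → Runs p t Q → Runs (tick p) (suc t) Q
    query  : ∀ {q k t Q} → Runs (k (answer 𝒢 q)) t Q → Runs (query q k) (suc t) Q
    pick   : ∀ {j k t Q} → (∀ i → Runs (k i) t Q) → Runs (pick j k) (suc t) Q
    call   : ∀ {c k t₁ t₂ t P Q} → Runs (body c) t₁ P → (∀ r → P r → Runs (k r) t₂ Q) →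
             t₁ + t₂ ≤ t → Runs (call c k) (suc t) Q

  weaken : ∀ {A : Set} {p : Prog n m A} {t t′ Q} → t ≤ t′ → Runs p t Q → Runs p t′ Q
  weaken le       (return q)    = return q
  weaken (s≤s le) (tick r)      = tick (weaken le r)
  weaken (s≤s le) (query r)     = query (weaken le r)
  weaken (s≤s le) (pick r)      = pick λ i → weaken le (r i)
  weaken (s≤s le) (call r s le′) = call r s (≤-trans le′ le)

  -- At a call the derivation for the callee stays untouched and only its continuation is extended.
  bind : ∀ {A B : Set} {p : Prog n m A} {f : A → Prog n m B} {t₁ t₂ P Q} →
    Runs p t₁ P → (∀ a → P a → Runs (f a) t₂ Q) → Runs (p >>= f) (t₁ + t₂) Q
  bind {t₁ = t₁} (return q) s = weaken (m≤n+m _ t₁) (s _ q)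
  bind (tick r)  s = tick (bind r s)
  bind (query r) s = query (bind r s)
  bind (pick r)  s = pick λ i → bind (r i) s
  bind {t₂ = t₂} (call {t₁ = u₁} {u₂} r k le) s = call r (λ a p → bind (k a p) s)
    (≤-trans (≤-reflexive (sym (+-assoc u₁ u₂ t₂))) (+-monoˡ-≤ t₂ le))

  post : ∀ {A : Set} {p : Prog n m A} {t} {P Q : A → Set} →
    (∀ {a} → P a → Q a) → Runs p t P → Runs p t Q
  post f (return q)    = return (f q)
  post f (tick r)      = tick (post f r)
  post f (query r)     = query (post f r)
  post f (pick r)      = pick λ i → post f (r i)
  post f (call r s le) = call r (λ a p → post f (s a p)) le

  -- Each step uses up one unit of budget, whichever alternative is picked. A call splices in the
  -- body of the callee, and `bind` merges the two budgets.
  runs-step : ∀ {A : Set} {p q : Prog n m A} {t Q} →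
    Runs p t Q → 𝒢 ⊢ p ⟶ q → ∃ λ t′ → t ≡ suc t′ × Runs q t′ Q
  runs-step (tick r)      (tick _)     = _ , refl , r
  runs-step (query r)     (query _ _)  = _ , refl , r
  runs-step (pick r)      (pick _ _ i) = _ , refl , r i
  runs-step (call r s le) (call _ _)   = _ , refl , weaken le (bind r s)

  runs-time : ∀ {A : Set} {p q : Prog n m A} {t t′ Q} →
    Runs p t Q → 𝒢 ⊢ p ⟶[ t′ ] q → t′ ≤ t
  runs-time r done = z≤n
  runs-time r (step s e) with runs-step r s
  ... | _ , refl , r′ = s≤s (runs-time r′ e)

  runs-result : ∀ {A : Set} {p : Prog n m A} {a t t′ Q} →
    Runs p t Q → 𝒢 ⊢ p ⟶[ t′ ] return a → Q a
  runs-result (return q) done = q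
  runs-result r (step s e) with runs-step r s
  ... | _ , _ , r′ = runs-result r′ e

  -- A pick has at least one alternative, so nothing but `return` is stuck. With the time bound,
  -- this makes every maximal execution end in a result.
  progress : ∀ {A : Set} (p : Prog n m A) → (∃ λ a → p ≡ return a) ⊎ (∃ λ q → 𝒢 ⊢ p ⟶ q)
  progress (return a)  = inj₁ (a , refl)
  progress (tick p)    = inj₂ (_ , tick p)
  progress (query q k) = inj₂ (_ , query q k)
  progress (pick j k)  = inj₂ (_ , pick j k zero)
  progress (call c k)  = inj₂ (_ , call c k)

  -- Loops and subset operations.

  ticks-runs : ∀ {A : Set} t {a : A} → Runs (ticks t (return a)) t (_≡ a)
  ticks-runs zero    = return refl
  ticks-runs (suc t) = tick (ticks-runs t)

  make-runs : ∀ S → Runs (make S) n (_≡ S)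
  make-runs S = ticks-runs n

  Decides : ∀ {A : Set} → (A → Prog n m Bool) → ℕ → (A → Set) → Set₁
  Decides test c P = ∀ x → Runs (test x) c (Reflects (P x))

  ask-runs : ∀ q {P : Set} → Reflects P (answer 𝒢 q) → Runs (ask q) 1 (Reflects P)
  ask-runs q r = query (return r)

  member-decides : ∀ S → Decides (λ u → ask (member? u S)) 1 (_∈ S)
  member-decides S u = ask-runs (member? u S) (member-reflects u S)

  -- The bound `k` replaces the exact length so that costs can be stated in `n` and `m`, although
  -- the lists depend on the input.
  select-runs : ∀ {A : Set} {test : A → Prog n m Bool} {c P} → Decides test c P →
    ∀ xs {k} → length xs ≤ k → Runs (select test xs) (k * suc c) (Selected P xs)
  select-runs d []       le = return selected-[]
  select-runs {c = c} d (x ∷ xs) {suc k} (s≤s le) = tick (bind (d x) λ b r →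
    -- The final `return` gets budget 0, which leaves a trailing `+ 0` to be removed.
    weaken (≤-reflexive (+-identityʳ _)) (bind (select-runs d xs le) λ ys s →
    return {t = 0} (selected-∷ r s)))

  some-decides : ∀ {A : Set} {test : A → Prog n m Bool} {c P} → Decides test c P →
    ∀ xs {k} → length xs ≤ k →
    Runs (select test xs >>= λ ys → return (not (null ys))) (k * suc c)
         (Reflects (∃ λ x → x ∈ₗ xs × P x))
  some-decides d xs le = weaken (≤-reflexive (+-identityʳ _))
    (bind (select-runs d xs le) λ ys s → return {t = 0} (selected-reflects s))

  none-decides : ∀ {A : Set} {test : A → Prog n m Bool} {c P} → Decides test c P →
    ∀ xs {k} → length xs ≤ k →
    Runs (select test xs >>= λ ys → return (null ys)) (k * suc c)
         (Reflects (¬ ∃ λ x → x ∈ₗ xs × P x))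
  none-decides {P = P} d xs le = weaken (≤-reflexive (+-identityʳ _))
    (bind (select-runs d xs le) λ ys s → return {t = 0} (negate ys (selected-reflects s)))
    where
    -- Splitting on `ys` lets the double negation `not (not (null ys))` compute.
    negate : ∀ {A B : Set} (ys : List A) → Reflects B (not (null ys)) → Reflects (¬ B) (null ys)
    negate []       = ¬-reflects
    negate (_ ∷ _)  = ¬-reflects

  record Lists (S : Subset n) (us : List (Fin n)) : Set where
    field
      from : ∀ {u} → u ∈ₗ us → u ∈ S
      to   : ∀ {u} → u ∈ S → u ∈ₗ us
      size : length us ≤ n

  elements-runs : ∀ S → Runs (elements S) (n * 2) (Lists S)
  elements-runs S = post lists (select-runs (member-decides S) (allFin n) (length-allFin n))
    where
    lists : ∀ {us} → Selected (_∈ S) (allFin n) us → Lists S us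
    lists s .Lists.from = proj₂ ∘ s .sound
    lists s .Lists.to   = s .complete (∈-allFin _)
    lists s .Lists.size = ≤-trans (s .size) (length-allFin n)

  ConflictList : Subset n → List (Fin n × Fin n) → Set
  ConflictList S cs = (∀ {u v} → (u , v) ∈ₗ cs → u ∈ S × v ∈ S × Conflicting 𝒢 u v)
                    × (∀ {u v} → u ∈ S → v ∈ S → Conflicting 𝒢 u v → (u , v) ∈ₗ cs)

  conflict-decides : Decides {A = Fin n × Fin n}
    (λ (u , v) → ask (conflict? u v)) 1 (λ (u , v) → Conflicting 𝒢 u v)
  conflict-decides (u , v) = ask-runs (conflict? u v) (T-reflects _)

  conflictsIn-runs : ∀ S → Runs (conflictsIn S) conflictsCost (ConflictList S)
  conflictsIn-runs S = bind (elements-runs S) λ us l →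
    post (λ s → (λ i → let j , c = s .sound i
                           a , b = ∈-cartesianProduct⁻ us us j
                       in Lists.from l a , Lists.from l b , c)
              , λ a b → s .complete (∈-cartesianProduct⁺ (Lists.to l a) (Lists.to l b)))
         (select-runs conflict-decides (cartesianProduct us us)
           (≤-trans (≤-reflexive (length-cartesianProduct us us))
                    (*-mono-≤ (Lists.size l) (Lists.size l))))

  remove-runs : ∀ u S → Runs (remove u S) n (_≡ S - u)
  remove-runs u S = make-runs (S - u)

  Without : (Fin n → Set) → Subset n → Subset n → Set
  Without D Y Z = (Z ⊆ Y) × (∀ {v} → v ∈ Z → ¬ D v) × (∀ {v} → v ∈ Y → ¬ D v → v ∈ Z)

  removeAll-runs : ∀ us Y {k} → length us ≤ k →
    Runs (removeAll us Y) (k * n) (Without (_∈ₗ us) Y)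
  removeAll-runs []       Y le = return (id , (λ _ ()) , λ v∈Y _ → v∈Y)
  removeAll-runs (u ∷ us) Y {suc k} (s≤s le) = bind (remove-runs u Y) λ { _ refl →
    post (λ (sub , out , keep) →
             p-x⊆p Y u ∘ sub
           , (λ { v∈Z (here refl) → x∉p-x Y u (sub v∈Z) ; v∈Z (there i) → out v∈Z i })
           , λ v∈Y ∉us → keep (x∈p∧x≢y⇒x∈p-y v∈Y (∉us ∘ here)) (∉us ∘ there))
         (removeAll-runs us (Y - u) le) }

  ConflictsWith : Subset n → Fin n → Set
  ConflictsWith X v = ∃ λ u → u ∈ X × Conflicting 𝒢 u v

  removeConflicting-runs : ∀ X Y →
    Runs (removeConflicting X Y) removeConflictingCost (Without (ConflictsWith X) Y)
  removeConflicting-runs X Y =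
    bind (elements-runs X) λ xs lx →
    bind (elements-runs Y) λ ys ly →
    bind (select-runs {P = ConflictsWith X}
           (λ v → post (reflects-map (λ (u , i , c) → u , Lists.from lx i , c)
                                     (λ (u , i , c) → u , Lists.to lx i , c))
                       (some-decides (λ u → ask-runs (conflict? u v) (T-reflects _))
                                     xs (Lists.size lx)))
           ys (Lists.size ly)) λ dead s →
    post (λ (sub , out , keep) →
             sub
           , (λ v∈Z c → out v∈Z (s .complete (Lists.to ly (sub v∈Z)) c))
           , λ v∈Y ¬c → keep v∈Y (¬c ∘ proj₂ ∘ s .sound))
         (removeAll-runs dead Y (≤-trans (s .size) (Lists.size ly)))

  -- Goodness and pruning.

  goodFor? : ∀ i Γ u → Dec (GoodFor 𝒢 i Γ u)
  goodFor? i Γ u = any? λ v → (v ∈? Γ) ×-dec T? (E i u v)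

  bad?-decides : ∀ {Y ys} → Lists Y ys → Decides (bad? ys) badCost (λ u → ¬ Good 𝒢 Y u)
  bad?-decides {Y} {ys} l u =
    post (reflects-map (λ (i , _ , ¬g) g → ¬g (g i)) failure)
      (some-decides {P = λ i → ¬ GoodFor 𝒢 i Y u}
        (λ i → post (reflects-map (λ ¬e (v , v∈Y , e) → ¬e (v , Lists.to l v∈Y , e))
                                  (λ ¬e (v , j , e) → ¬e (v , Lists.from l j , e)))
                    (none-decides (λ v → ask-runs (edge? i u v) (T-reflects _)) ys (Lists.size l)))
        (allFin m) (length-allFin m))
    where
    -- A failing index can be found constructively by search, since there are finitely many graphs
    -- and `GoodFor` is decidable.
    failure : ¬ Good 𝒢 Y u → ∃ λ i → i ∈ₗ allFin m × ¬ GoodFor 𝒢 i Y u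
    failure ¬g with ¬∀⟶∃¬ m _ (λ i → goodFor? i Y u) ¬g
    ... | i , ¬gi = i , ∈-allFin i , ¬gi

  good? : ∀ Γ u → Dec (Good 𝒢 Γ u)
  good? Γ u = all? λ i → goodFor? i Γ u

  AllGood : Subset n → Set
  AllGood Γ = ∀ {u} → u ∈ Γ → Good 𝒢 Γ u

  -- This determines `Z` as the largest all-good subset of `Y`, so the order in which bad vertices
  -- are picked does not matter.
  Pruned : Subset n → Subset n → Set
  Pruned Y Z = (Z ⊆ Y) × AllGood Z × (∀ {Γ} → AllGood Γ → Γ ⊆ Y → Γ ⊆ Z)

  good-mono : ∀ {Γ Δ u} → Γ ⊆ Δ → Good 𝒢 Γ u → Good 𝒢 Δ u
  good-mono Γ⊆Δ g i = let v , v∈Γ , e = g i in v , Γ⊆Δ v∈Γ , e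

  -- A vertex bad in `Y` is bad in every subset of `Y` that contains it, so no all-good `Γ` can
  -- contain it.
  pruned-remove : ∀ {Y Z u} → ¬ Good 𝒢 Y u → Pruned (Y - u) Z → Pruned Y Z
  pruned-remove {Y} {Z} {u} bad (sub , good , max) =
    p-x⊆p Y u ∘ sub , good ,
    λ g Γ⊆Y → max g (p⊆q∧x∉p⇒p⊆q-x Γ⊆Y λ u∈Γ → bad (good-mono Γ⊆Y (g u∈Γ)))

  pruneBody-runs : ∀ k Y → ∣ Y ∣ ≤ k → Runs (pruneBody Y) (pruneCost k) (Pruned Y)
  pruneBody-runs k Y le = weaken (≤-reflexive (regroup (n * 2) (n * suc badCost) n (k * pruneRound)))
    (bind (elements-runs Y) λ ys l →
     bind (select-runs (bad?-decides l) ys (Lists.size l)) λ bads s → go k le bads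
       (λ i → let j , ¬g = s .sound i in Lists.from l j , ¬g)
       (λ u∈Y ¬g → s .complete (Lists.to l u∈Y) ¬g))
    where
    regroup : ∀ a b c d → a + (b + suc (c + suc d)) ≡ (a + (b + suc (c + 1))) + d
    regroup = solve-∀
    go : ∀ k → ∣ Y ∣ ≤ k → ∀ bads → (∀ {u} → u ∈ₗ bads → u ∈ Y × ¬ Good 𝒢 Y u) →
      (∀ {u} → u ∈ Y → ¬ Good 𝒢 Y u → u ∈ₗ bads) →
      Runs (pruneWith Y bads) (suc (n + suc (k * pruneRound))) (Pruned Y)
    -- An empty list of bad vertices yields only that no vertex fails to be good; decidability turns
    -- this into goodness.
    go k le [] _ complete = return
      (id , (λ {u} u∈Y → decidable-stable (good? Y u) λ ¬g → ⊥-elim (¬Any[] (complete u∈Y ¬g))) , λ _ Γ⊆Y → Γ⊆Y)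
    go zero le (b ∷ bs) sound _ = ⊥-elim (n≮0 (≤-trans (x∈p⇒∣p-x∣<∣p∣ (proj₁ (sound (here refl)))) le))
    go (suc k) le (b ∷ bs) sound _ = pick λ i →
      let u = lookup (b ∷ bs) i
          u∈Y , ¬g = sound (∈-lookup i)
      in bind (remove-runs u Y) λ { _ refl →
         call (pruneBody-runs k (Y - u) (≤-pred (≤-trans (x∈p⇒∣p-x∣<∣p∣ u∈Y) le)))
              (λ Z p → return {t = 0} (pruned-remove ¬g p))
              (≤-reflexive (+-identityʳ _)) }

  -- Correctness and cost of the recursion.

  Verdict : Subset n → Subset n → Bool → Set
  -- A positive answer is passed up unchanged and needs no bounds; negative answers need them in
  -- order to be combined.
  Verdict X Y true  = HasGIS 𝒢
  Verdict X Y false = ∀ {Γ} → IsGIS 𝒢 Γ → X ⊆ Γ → ¬ (Γ ⊆ Y)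

  Separated : Subset n → Subset n → Set
  Separated X Z = ∀ {u v} → u ∈ X → v ∈ Z → ¬ Conflicting 𝒢 u v

  -- Used to transfer the verdict on the reduced set back to `Y`: the reduction loses no candidate.
  verdict-mono : ∀ {X Y Z} b → (∀ {Γ} → IsGIS 𝒢 Γ → X ⊆ Γ → Γ ⊆ Y → Γ ⊆ Z) →
    Verdict X Z b → Verdict X Y b
  verdict-mono true  _   gis = gis
  verdict-mono false max none gis X⊆Γ Γ⊆Y = none gis X⊆Γ (max gis X⊆Γ Γ⊆Y)

  conflict-sym : ∀ {u v} → Conflicting 𝒢 u v → Conflicting 𝒢 v u
  conflict-sym {u} {v} = subst T (E₀-sym u v)

  conflict-irrefl : ∀ {u v} → Conflicting 𝒢 u v → u ≢ v
  conflict-irrefl {u} c refl = subst T (E₀-irrefl u) c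

  verdict-branch : ∀ {X Y u v} → Conflicting 𝒢 u v →
    Verdict X (Y - u) false → ∀ b → Verdict (X ∪ ⁅ u ⁆) (Y - v) b → Verdict X Y b
  verdict-branch c none₁ true  gis = gis
  verdict-branch {u = u} c none₁ false none₂ {Γ} gis@(_ , ind , _) X⊆Γ Γ⊆Y with u ∈? Γ
  ... | no  u∉Γ = none₁ gis X⊆Γ (p⊆q∧x∉p⇒p⊆q-x Γ⊆Y u∉Γ)
  ... | yes u∈Γ = none₂ gis (⊆-insert X⊆Γ u∈Γ)
                    (p⊆q∧x∉p⇒p⊆q-x Γ⊆Y λ v∈Γ → ind u∈Γ v∈Γ c)

  LasVegasRuns : ℕ → Set₁
  LasVegasRuns k = ∀ X Y → ∣ Y ─ X ∣ ≤ k →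
    Runs (lasVegasBody X Y) (calls k * lasVegasRound) (Verdict X Y)

  branch-runs : ∀ k → (∀ {j} → j < k → LasVegasRuns j) → ∀ X Y → ∣ Y ─ X ∣ ≤ k → Nonempty Y → AllGood Y → Separated X Y →
    ∀ cs → ConflictList Y cs →
    Runs (branch X Y cs) (branchCost + childCalls k * lasVegasRound) (Verdict X Y)
  -- `Y` itself is the witness: pruning made it all-good, and a complete list of conflicts that is
  -- empty makes it independent.
  branch-runs k rec X Y le ne good sep [] (_ , complete) = return
    (Y , ne , (λ u∈Y v∈Y c → ¬Any[] (complete u∈Y v∈Y c)) , good)
  branch-runs k rec X Y le ne good sep (c ∷ cs) (sound , _) = pick λ i →
    let u , v = lookup (c ∷ cs) i
        u∈Y , v∈Y , uv = sound (∈-lookup i)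
        u∉X = λ u∈X → sep u∈X v∈Y uv
        v∉X = λ v∈X → sep v∈X u∈Y (conflict-sym uv)
    in go k rec u v uv (≤-trans (∣Y-u─X∣<∣Y─X∣ u∈Y u∉X) le)
                   (∣Y-v─X∪u∣<∣Y-u─X∣ v∈Y v∉X (conflict-irrefl uv))
    where
    L = lasVegasRound
    after : Fin n → Fin n → Subset n → Prog n m Bool
    after u v Y₁ = call (lasVegas X Y₁) λ found → if found then return true else
      (insert u X >>= λ X₂ → remove v Y >>= λ Y₂ → invoke (lasVegas X₂ Y₂))
    regroup : ∀ n a b → n + suc (a + (n + (n + suc b))) ≡ (n + suc (n + (n + 1))) + (a + b)
    regroup = solve-∀
    go : ∀ k → (∀ {j} → j < k → LasVegasRuns j) → ∀ u v → Conflicting 𝒢 u v → ∣ (Y - u) ─ X ∣ < k →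
      ∣ (Y - v) ─ (X ∪ ⁅ u ⁆) ∣ < ∣ (Y - u) ─ X ∣ →
      Runs (remove u Y >>= after u v) ((n + suc (n + (n + 1))) + childCalls k * L) (Verdict X Y)
    -- A conflicting pair accounts for two undecided vertices; hence `childCalls` may vanish at 0
    -- and 1.
    go (suc zero) _ u v uv lt₁ lt₂ = ⊥-elim (n≮0 (≤-trans lt₂ (≤-pred lt₁)))
    go (suc (suc k)) rec u v uv (s≤s le₁) lt₂ = weaken (≤-reflexive cost)
      (bind (remove-runs u Y) λ { _ refl →
       call (rec ≤-refl X (Y - u) le₁)
         -- A positive first answer skips the second call; `return` fits any budget, so the bound
         -- for two calls covers both cases.
         (λ { true  gis   → return gis
            ; false none₁ →
              bind (make-runs (X ∪ ⁅ u ⁆)) λ { _ refl →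
              bind (remove-runs v Y) λ { _ refl →
              call (rec (n≤1+n _) (X ∪ ⁅ u ⁆) (Y - v) (≤-pred (≤-trans lt₂ le₁)))
                (λ b verdict → return {t = 0} (verdict-branch uv none₁ b verdict))
                (≤-reflexive (+-identityʳ _)) } } })
         ≤-refl })
      where
      cost : n + suc (calls (suc k) * L + (n + (n + suc (calls k * L))))
           ≡ (n + suc (n + (n + 1))) + (calls (suc k) + calls k) * L
      cost = trans (regroup n (calls (suc k) * L) (calls k * L))
        (cong ((n + suc (n + (n + 1))) +_) (sym (*-distribʳ-+ L (calls (suc k)) (calls k))))

  lasVegas-step : ∀ k → (∀ {j} → j < k → LasVegasRuns j) → LasVegasRuns k
  lasVegas-step k rec X Y le = weaken (≤-reflexive cost)
    (bind (conflictsIn-runs X) λ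
      { (c ∷ cs) (sound , _) → return λ (_ , ind , _) X⊆Γ _ →
          let u∈X , v∈X , uv = sound (here refl) in ind (X⊆Γ u∈X) (X⊆Γ v∈X) uv
      ; [] _ →
    bind (removeConflicting-runs X Y) λ Y₁ (Y₁⊆Y , apart , keep) →
    call (pruneBody-runs n Y₁ (∣p∣≤n Y₁)) (λ Y₂ (Y₂⊆Y₁ , good , max) →
    bind (elements-runs X) λ xs lx →
    bind (elements-runs Y₂) λ ys ly →
    bind (select-runs (λ u → query (return (¬-reflects (member-reflects u Y₂)))) xs
                        (Lists.size lx)) λ missing s →
    finish (Y₁⊆Y ∘ Y₂⊆Y₁) good
      (λ u∈X v∈Y₂ c → apart (Y₂⊆Y₁ v∈Y₂) (_ , u∈X , c))
      (λ (_ , ind , good′) X⊆Γ Γ⊆Y → max good′ λ x∈Γ →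
         keep (Γ⊆Y x∈Γ) λ (u , u∈X , c) → ind (X⊆Γ u∈X) x∈Γ c)
      missing ys lx ly s) ≤-refl })
    where
    R = childCalls k * lasVegasRound
    finish : ∀ {Y₂ xs} → Y₂ ⊆ Y → AllGood Y₂ → Separated X Y₂ →
      (∀ {Γ} → IsGIS 𝒢 Γ → X ⊆ Γ → Γ ⊆ Y → Γ ⊆ Y₂) →
      ∀ missing ys → Lists X xs → Lists Y₂ ys → Selected (_∉ Y₂) xs missing →
      Runs (if not (null missing) ∨ null ys then return false else
              (conflictsIn Y₂ >>= branch X Y₂))
           (conflictsCost + (branchCost + R)) (Verdict X Y)
    -- Every candidate `Γ` lies in `Y₂`, so a vertex of `X` lost from `Y₂`, or an empty `Y₂`,
    -- excludes it.
    finish _ _ _ maximal (u ∷ _) ys lx ly s = return λ gis X⊆Γ Γ⊆Y →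
      let u∈xs , u∉Y₂ = s .sound (here refl)
      in u∉Y₂ (maximal gis X⊆Γ Γ⊆Y (X⊆Γ (Lists.from lx u∈xs)))
    finish _ _ _ maximal [] [] lx ly s = return λ gis@((w , w∈Γ) , _) X⊆Γ Γ⊆Y →
      ¬Any[] (Lists.to ly (maximal gis X⊆Γ Γ⊆Y w∈Γ))
    finish {Y₂} Y₂⊆Y good sep maximal [] (y ∷ _) lx ly s =
      bind (conflictsIn-runs Y₂) λ cs list →
      post (λ {b} → verdict-mono b maximal)
        -- Steps (2) and (3) only shrink `Y`, so `k` still bounds the undecided vertices.
        (branch-runs k rec X Y₂ (≤-trans (p⊆q⇒∣p∣≤∣q∣ (─-monoˡ-⊆ X Y₂⊆Y)) le)
          (y , Lists.from ly (here refl)) good sep cs list)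
    regroup : ∀ c r p e d b x →
      c + (r + suc (p + (e + (e + (e + (d + (b + x))))))) ≡
      (c + (r + suc (p + (e + (e + (e + (d + b))))))) + x
    regroup = solve-∀
    cost : conflictsCost + (removeConflictingCost + suc (pruneCost n +
      (n * 2 + (n * 2 + (n * 2 + (conflictsCost + (branchCost + R))))))) ≡ lasVegasRound + R
    cost = regroup conflictsCost removeConflictingCost (pruneCost n) (n * 2) conflictsCost branchCost R

  -- Course-of-values induction, because the second recursive call descends by two.
  lasVegas-runs : ∀ k → LasVegasRuns k
  lasVegas-runs = <-rec LasVegasRuns lasVegas-step

  algorithmB-runs : Runs (algorithmB n m) (n + (n + suc (calls n * lasVegasRound))) (Verdict ⊥ ⊤)
  algorithmB-runs =
    bind (make-runs ⊥) λ { _ refl →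
    bind (make-runs ⊤) λ { _ refl →
    call (lasVegas-runs n ⊥ ⊤ (∣p∣≤n (⊤ ─ ⊥))) (λ _ verdict → return {t = 0} verdict)
         (≤-reflexive (+-identityʳ _)) } }

  -- Every set lies between `⊥` and `⊤`, so here a negative verdict excludes all good independent
  -- sets.
  verdict-correct : ∀ b → Verdict ⊥ ⊤ b → b ≡ true ⇔ HasGIS 𝒢
  verdict-correct true  gis  = mk⇔ (const gis) (const refl)
  verdict-correct false none = mk⇔ (λ ()) λ (Γ , gis) →
    ⊥-elim (none gis (⊥-elim ∘ ∉⊥) (const ∈⊤))

-- Growth rates and the final time bound.

calls-growth : ∀ a b → b ≤ a → b * a + b * b ≤ a * a → ∀ k → suc (calls k) * b ^ k ≤ 2 * a ^ k
calls-growth a b b≤a b²+ba≤a² zero = ≤-refl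
calls-growth a b b≤a b²+ba≤a² (suc zero) = *-monoʳ-≤ 2 (*-monoˡ-≤ 1 b≤a)
-- Adding 1 to `calls` makes its recurrence the homogeneous Fibonacci one, with initial values 2 and
-- 2. The hypothesis on squares says that `a / b` is at least the golden ratio.
calls-growth a b b≤a b²+ba≤a² (suc (suc k)) = begin
  (2 + (c₁ + c₀)) * (b * (b * b ^ k))                     ≡⟨ split c₁ c₀ b (b ^ k) ⟩
  b * (suc c₁ * (b * b ^ k)) + b * b * (suc c₀ * b ^ k)
    ≤⟨ +-mono-≤ (*-monoʳ-≤ b (calls-growth a b b≤a b²+ba≤a² (suc k)))
                (*-monoʳ-≤ (b * b) (calls-growth a b b≤a b²+ba≤a² k)) ⟩
  b * (2 * (a * a ^ k)) + b * b * (2 * a ^ k)             ≡⟨ join a b (a ^ k) ⟩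
  2 * ((b * a + b * b) * a ^ k)                           ≤⟨ *-monoʳ-≤ 2 (*-monoˡ-≤ (a ^ k) b²+ba≤a²) ⟩
  2 * (a * a * a ^ k)                                     ≡⟨ cong (2 *_) (*-assoc a a (a ^ k)) ⟩
  2 * (a * (a * a ^ k))                                   ∎
  where
  open ≤-Reasoning
  c₁ = calls (suc k)
  c₀ = calls k
  split : ∀ c₁ c₀ b x →
    (2 + (c₁ + c₀)) * (b * (b * x)) ≡ b * (suc c₁ * (b * x)) + b * b * (suc c₀ * x)
  split = solve-∀
  join : ∀ a b x → b * (2 * (a * x)) + b * b * (2 * x) ≡ 2 * ((b * a + b * b) * x)
  join = solve-∀

^-distribʳ-* : ∀ k x y → (x * y) ^ k ≡ x ^ k * y ^ k
^-distribʳ-* zero    x y = refl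
^-distribʳ-* (suc k) x y =
  trans (cong (x * y *_) (^-distribʳ-* k x y)) ([m*n]*[o*p]≡[m*o]*[n*p] x y (x ^ k) (y ^ k))

-- Bernoulli's inequality for `(1 + 1/b)^n`, with denominators cleared. The term `n * b ^ n` is the
-- excess of `suc b * (b + n)` over `(b + suc n) * b`, times `b ^ n`.
bernoulli : ∀ b n → (b + n) * b ^ n ≤ b * suc b ^ n
bernoulli b zero    = ≤-reflexive (cong (_* 1) (+-identityʳ b))
bernoulli b (suc n) = begin
  (b + suc n) * (b * b ^ n)         ≤⟨ m≤m+n _ (n * b ^ n) ⟩
  (b + suc n) * (b * b ^ n) + n * b ^ n ≡⟨ factor b n (b ^ n) ⟩
  suc b * ((b + n) * b ^ n)         ≤⟨ *-monoʳ-≤ (suc b) (bernoulli b n) ⟩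
  suc b * (b * suc b ^ n)           ≡⟨ swap b (suc b ^ n) ⟩
  b * (suc b * suc b ^ n)           ∎
  where
  open ≤-Reasoning
  factor : ∀ b n x → (b + suc n) * (b * x) + n * x ≡ suc b * ((b + n) * x)
  factor = solve-∀
  swap : ∀ b x → suc b * (b * x) ≡ b * (suc b * x)
  swap = solve-∀

linear≤exponential : ∀ b .{{_ : NonZero b}} n → suc n * b ^ n ≤ b * suc b ^ n
linear≤exponential b n = ≤-trans (*-monoˡ-≤ (b ^ n) (+-monoˡ-≤ n (>-nonZero⁻¹ b))) (bernoulli b n)

-- The `d`-th power of the linear case. The rate `((b + 1) / b)^d` comes as close to 1 as desired
-- for large `b`.
power≤exponential : ∀ d b .{{_ : NonZero b}} n → suc n ^ d * (b ^ d) ^ n ≤ b ^ d * (suc b ^ d) ^ n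
power≤exponential d b n = begin
  suc n ^ d * (b ^ d) ^ n     ≡⟨ cong (suc n ^ d *_) (^-comm b d) ⟩
  suc n ^ d * (b ^ n) ^ d     ≡⟨ ^-distribʳ-* d (suc n) (b ^ n) ⟨
  (suc n * b ^ n) ^ d         ≤⟨ ^-monoˡ-≤ d (linear≤exponential b n) ⟩
  (b * suc b ^ n) ^ d         ≡⟨ ^-distribʳ-* d b (suc b ^ n) ⟩
  b ^ d * (suc b ^ n) ^ d     ≡⟨ cong (b ^ d *_) (^-comm (suc b) d) ⟨
  b ^ d * (suc b ^ d) ^ n     ∎
  where
  open ≤-Reasoning
  ^-comm : ∀ x d → (x ^ d) ^ n ≡ (x ^ n) ^ d
  ^-comm x d = trans (^-*-assoc x d n) (trans (cong (x ^_) (*-comm d n)) (sym (^-*-assoc x n d)))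

-- Growth rates a/b and e/f multiply to at most q/p, with all denominators cleared.
combine-growth : ∀ {x y A B} a b e f p q .{{_ : NonZero b}} .{{_ : NonZero f}} n →
  x * b ^ n ≤ A * a ^ n → y * f ^ n ≤ B * e ^ n → a * e * p ≤ q * (b * f) →
  x * y * p ^ n ≤ A * B * q ^ n
combine-growth {x} {y} {A} {B} a b e f p q n hx hy rate =
  *-cancelʳ-≤ _ _ ((b * f) ^ n) {{m^n≢0 (b * f) n {{m*n≢0 b f}}}} (begin
  x * y * p ^ n * (b * f) ^ n           ≡⟨ cong (x * y * p ^ n *_) (^-distribʳ-* n b f) ⟩
  x * y * p ^ n * (b ^ n * f ^ n)       ≡⟨ shuffle x y (p ^ n) (b ^ n) (f ^ n) ⟩
  x * b ^ n * (y * f ^ n) * p ^ n       ≤⟨ *-monoˡ-≤ (p ^ n) (*-mono-≤ hx hy) ⟩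
  A * a ^ n * (B * e ^ n) * p ^ n       ≡⟨ unshuffle A B (p ^ n) (a ^ n) (e ^ n) ⟩
  A * B * (a ^ n * e ^ n * p ^ n)       ≡⟨ cong (λ z → A * B * (z * p ^ n)) (^-distribʳ-* n a e) ⟨
  A * B * ((a * e) ^ n * p ^ n)         ≡⟨ cong (A * B *_) (^-distribʳ-* n (a * e) p) ⟨
  A * B * (a * e * p) ^ n               ≤⟨ *-monoʳ-≤ (A * B) (^-monoˡ-≤ n rate) ⟩
  A * B * (q * (b * f)) ^ n             ≡⟨ cong (A * B *_) (^-distribʳ-* n q (b * f)) ⟩
  A * B * (q ^ n * (b * f) ^ n)         ≡⟨ *-assoc (A * B) (q ^ n) _ ⟨
  A * B * q ^ n * (b * f) ^ n           ∎)
  where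
  open ≤-Reasoning
  shuffle : ∀ x y p b f → x * y * p * (b * f) ≡ x * b * (y * f) * p
  shuffle = solve-∀
  unshuffle : ∀ x y p b f → x * b * (y * f) * p ≡ x * y * (b * f * p)
  unshuffle = solve-∀

round-bound : ∀ n m → 1 ≤ m → suc (n + n) + Cost.lasVegasRound n m ≤ 26 * m * suc n ^ 3
round-bound n (suc m) _ = ≤-trans (m≤m+n _ (slack n m)) (≤-reflexive (expand n m))
  where
  -- The right side minus the left as a polynomial, where `m` is one less than the number of graphs.
  -- The constant 26 is generous and keeps all coefficients natural.
  slack : ℕ → ℕ → ℕ
  slack n m = 19 + 51 * n + 64 * n * n + 24 * n * n * n
            + m * (26 + 77 * n + 75 * n * n + 24 * n * n * n)
  expand : ∀ n m → suc (n + n) + ((n * 2 + n * n * 2) +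
    ((n * 2 + (n * 2 + (n * suc (n * 2) + n * n))) +
     suc (suc n * (n * 2 + (n * suc (suc m * suc (n * 2)) + suc (n + 1))) +
      (n * 2 + (n * 2 + (n * 2 + ((n * 2 + n * n * 2) + suc (n + suc (n + (n + 1)))))))))) +
    (19 + 51 * n + 64 * n * n + 24 * n * n * n + m * (26 + 77 * n + 75 * n * n + 24 * n * n * n))
    ≡ 26 * suc m * (suc n * (suc n * (suc n * 1)))
  expand = solve-∀

total-bound : ∀ n m → 1 ≤ m →
  n + (n + suc (calls n * Cost.lasVegasRound n m)) ≤ 26 * m * (calls n * suc n ^ 3)
total-bound n m m≥1 = begin
  n + (n + suc (calls n * L))       ≡⟨ regroup n (calls n * L) ⟩
  -- There is at least one call, so charging the setup once per call covers it.
  suc (n + n) + calls n * L         ≤⟨ +-monoˡ-≤ (calls n * L) (m≤m+n (suc (n + n)) _) ⟩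
  calls n * suc (n + n) + calls n * L ≡⟨ *-distribˡ-+ (calls n) (suc (n + n)) L ⟨
  calls n * (suc (n + n) + L)       ≤⟨ *-monoʳ-≤ (calls n) (round-bound n m m≥1) ⟩
  calls n * (26 * m * suc n ^ 3)    ≡⟨ swap (calls n) (26 * m) (suc n ^ 3) ⟩
  26 * m * (calls n * suc n ^ 3)    ∎
  where
  open ≤-Reasoning
  L = Cost.lasVegasRound n m
  regroup : ∀ n x → n + (n + suc x) ≡ suc (n + n) + x
  regroup = solve-∀
  swap : ∀ c k w → c * (k * w) ≡ k * (c * w)
  swap = solve-∀

time-bound : ∀ {t} K m c w p q A n → t ≤ K * m * (c * w) → c * w * p ^ n ≤ A * q ^ n →
  t * p ^ n ≤ K * A * m ^ 1 * q ^ n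
time-bound {t} K m c w p q A n ht hcw = begin
  t * p ^ n                  ≤⟨ *-monoˡ-≤ (p ^ n) ht ⟩
  K * m * (c * w) * p ^ n    ≡⟨ *-assoc (K * m) (c * w) (p ^ n) ⟩
  K * m * (c * w * p ^ n)    ≤⟨ *-monoʳ-≤ (K * m) hcw ⟩
  K * m * (A * q ^ n)        ≡⟨ regroup K m A (q ^ n) ⟩
  K * A * (m * 1) * q ^ n    ∎
  where
  open ≤-Reasoning
  regroup : ∀ k m a x → k * m * (a * x) ≡ k * a * (m * 1) * x
  regroup = solve-∀

-- The last hypothesis reads `(a/b) * ((c+1)/c)^3 ≤ q/p`: the branching rate times the rate that
-- absorbs a cubic factor.
calls-bound : ∀ a b c p q .{{_ : NonZero b}} .{{_ : NonZero c}} →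
  b ≤ a → b * a + b * b ≤ a * a → a * suc c ^ 3 * p ≤ q * (b * c ^ 3) →
  ∀ n → calls n * suc n ^ 3 * p ^ n ≤ 2 * c ^ 3 * q ^ n
calls-bound a b c p q b≤a b²+ba≤a² rate n = combine-growth {calls n} {suc n ^ 3} {2} {c ^ 3}
  a b (suc c ^ 3) (c ^ 3) p q {{it}} {{m^n≢0 c 3}} n
  (≤-trans (*-monoˡ-≤ (b ^ n) (n≤1+n (calls n))) (calls-growth a b b≤a b²+ba≤a² n))
  (power≤exponential 3 c n) rate

-- 40451/25000 = 1.61804 lies between the golden ratio and 1.6181, and leaves room
-- for the factor (100001/100000)³ that absorbs the cubic cost of a single call.
calls-bound-1·6181 : ∀ n → calls n * suc n ^ 3 * 10000 ^ n ≤ 2 * 100000 ^ 3 * 16181 ^ n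
calls-bound-1·6181 = calls-bound 40451 25000 100000 10000 16181
  (≤ᵇ⇒≤ 25000 40451 _)
  (≤ᵇ⇒≤ (25000 * 40451 + 25000 * 25000) (40451 * 40451) _)
  (≤ᵇ⇒≤ (40451 * 100001 ^ 3 * 10000) (16181 * (25000 * 100000 ^ 3)) _)

theorem2p3 : ∃ λ (C : ℕ) → ∃ λ (d : ℕ) →
    ∀ (n m : ℕ) (𝒢 : GraphSystem n m) →
    (∀ (t : ℕ) (b : Bool) → 𝒢 ⊢ algorithmB n m ⟶[ t ] return b →
    (b ≡ true ⇔ HasGIS 𝒢))
    × (∀ (t : ℕ) (p : Prog n m Bool) → 𝒢 ⊢ algorithmB n m ⟶[ t ] p →
    (∃ λ (b : Bool) → p ≡ return b) ⊎ (∃ λ (q : Prog n m Bool) → 𝒢 ⊢ p ⟶ q))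
    × (∀ (t : ℕ) (p : Prog n m Bool) → 𝒢 ⊢ algorithmB n m ⟶[ t ] p →
    t * 10000 ^ n ≤ C * m ^ d * 16181 ^ n)
-- The factor 26 is from `round-bound`, 2 from the initial values of the recurrence, `100000 ^ 3`
-- from absorbing the cubic factor. The exponent 1 suffices since only the badness tests scan the
-- directed graphs.
theorem2p3 = 26 * (2 * 100000 ^ 3) , 1 , λ n m 𝒢 →
    (λ t b e → verdict-correct 𝒢 b (runs-result 𝒢 (algorithmB-runs 𝒢) e))
  , (λ t p _ → progress 𝒢 p)
  , λ t p e → time-bound 26 m (calls n) (suc n ^ 3) 10000 16181 (2 * 100000 ^ 3) n
      (≤-trans (runs-time 𝒢 (algorithmB-runs 𝒢) e) (total-bound n m (GraphSystem.m≥1 𝒢)))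
      (calls-bound-1·6181 n)
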